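{- Let $m\geq 1$. For a descending plane partition $\pi$ of dimension $m$ without special parts, and for $1\leq i\leq m-1$, let $a_i(\pi)$ be the number of parts of $\pi$ (counted with repetition) that are equal to $m-i+1$. Then $\pi\mapsto (a_1(\pi),a_2(\pi),\dots,a_{m-1}(\pi))$ is a bijection from the set of descending plane partitions of dimension $m$ without special parts onto the set of integer words $(a_1,\dots,a_{m-1})$ satisfying $0\leq a_i\leq m-i$ for all $i=1,\dots,m-1$. Consequently, assigning to $\pi$ the unique permutation $\sigma\in\mathfrak{S}_m$ whose inversion word is $(a_1(\pi),\dots,a_{m-1}(\pi))$ gives a bijection from the set of descending plane partitions of dimension $m$ without special parts onto $\mathfrak{S}_m$ (equivalently, onto the set of $m\times m$ permutation matrices). Moreover, under this bijection, the total number of parts of $\pi$ equals the number of inversions of $\sigma$, and if exactly $k-1$ parts of $\pi$ are equal to $m$, then the entry $1$ in the first row of the permutation matrix of $\sigma$ is in position (column) $k$.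
   Context: A descending plane partition is a (possibly empty) array $\pi=(a_{i,j})$ of positive integers with rows $i=1,\dots,k$, where row $i$ is nonempty and consists of the entries $a_{i,i},a_{i,i+1},\dots,a_{i,\mu_i}$ (so $\mu_i\geq i$ and row $i$ has length $\mu_i-i+1$), such that: (1) rows are weakly decreasing: $a_{i,j}\geq a_{i,j+1}$ for $1\leq i\leq k$ and $i\leq j<\mu_i$; (2) columns are strictly decreasing: $a_{i,j}>a_{i+1,j}$ for $1\leq i\leq k-1$ and $i<j\leq\mu_{i+1}$; (3) $a_{i,i}>\mu_i-i+1$ for $1\leq i\leq k$, i.e. the first part of each row is greater than the length of that row; (4) $a_{i,i}\leq\mu_{i-1}-(i-1)+1$ for $2\leq i\leq k$, i.e. the first part of each row is at most the length of the preceding row. (These conditions imply $\mu_1\geq\mu_2\geq\cdots\geq\mu_k\geq k$.) The empty array is a descending plane partition. The parts of $\pi$ are the numbers, with repetitions, appearing in the array. $\pi$ has dimension $m$ if no part is greater than $m$. A part $a_{i,j}$ is special if it does not exceed the number of parts to its left in its row, i.e. if $a_{i,j}\leq j-i$. For a permutation $\sigma\in\mathfrak{S}_m$ of $\{1,\dots,m\}$, an inversion is a pair $(i,j)$ with $i<j$ and $\sigma(i)>\sigma(j)$. The inversion word of $\sigma$ is $(a_1,\dots,a_{m-1})$, where $a_k$ is the number of inversions $(i,j)$ with $\sigma(j)=k$; that is, $a_k$ is the number of elements greater than $k$ standing to the left of $k$ in the word $(\sigma(1),\dots,\sigma(m))$. Every integer word $(b_1,\dots,b_{m-1})$ with $0\leq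 b_k\leq m-k$ is the inversion word of a unique permutation in $\mathfrak{S}_m$. The permutation matrix of $\sigma$ is the $m\times m$ matrix $M$ with $M_{i,j}=1$ if $\sigma(j)=i$ and $M_{i,j}=0$ otherwise. -}

module Defs where

open import Data.Bool.Base using (if_then_else_)
open import Data.Fin.Base as Fin using (Fin; toℕ)
import Data.Fin.Properties as Fin
open import Data.Fin.Permutation using (Permutation′; _⟨$⟩ʳ_)
open import Data.List.Base as List
  using (List; filter; concatMap; cartesianProduct; allFin)
open import Data.List.NonEmpty.Base using (List⁺; head; length; toList)
open import Data.List.Relation.Unary.All using (All)
open import Data.List.Relation.Unary.Linked using (Linked)
open import Data.Nat.Base using (ℕ; suc; _∸_; _≤_; _≥_; _<_; _>_)
import Data.Nat.Properties as ℕ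
open import Data.Product.Base using (Σ-syntax; _×_; _,_; proj₁; proj₂; uncurry)
open import Function.Base using (_∘_)
open import Level using (0ℓ)
open import Relation.Binary.Bundles using (Setoid)
import Relation.Binary.Construct.On as On
open import Relation.Binary.PropositionalEquality
  using (_≡_; setoid; _→-setoid_)
open import Relation.Nullary.Decidable using (does; _×-dec_)
open import Relation.Nullary.Negation using (¬_)

-- The i-th row (a_{i,i}, …, a_{i,μᵢ}) is stored as a nonempty list, without
-- its shift: a_{i,j} is the entry at (zero-based) position j - i, and the
-- length of the row is μᵢ - i + 1.

Row : Set
Row = List⁺ ℕ

Array : Set
Array = List Row

-- For consecutive rows r = row i and s = row (i+1), the entry of s at position
-- p is a_{i+1,i+1+p}; the entry a_{i,i+1+p} above it is at position p + 1 of r.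

ColumnsDecrease : Row → Row → Set
ColumnsDecrease r s =
  (p : Fin (length s)) (q : Fin (length r)) → toℕ q ≡ suc (toℕ p) →
  List.lookup (toList r) q > List.lookup (toList s) p

record IsDescendingPlanePartition (π : Array) : Set where
  field
    positive           : All (All (_> 0) ∘ toList) π
    rowsWeaklyDecrease : All (Linked _≥_ ∘ toList) π
    columnsDecrease    : Linked ColumnsDecrease π
    head>length        : All (λ r → head r > length r) π
    head≤prevLength    : Linked (λ r s → head s ≤ length r) π

parts : Array → List ℕ
parts = concatMap toList

HasDimension : ℕ → Array → Set
HasDimension m π = All (_≤ m) (parts π)

-- The number of parts to the left of position p in a row is toℕ p.

SpecialAt : (r : Row) → Fin (length r) → Set
SpecialAt r p = List.lookup (toList r) p ≤ toℕ p

NoSpecialParts : Array → Set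
NoSpecialParts = All (λ r → ∀ p → ¬ SpecialAt r p)

record DPPWithoutSpecialParts (m : ℕ) : Set where
  field
    array          : Array
    isDPP          : IsDescendingPlanePartition array
    hasDimension   : HasDimension m array
    noSpecialParts : NoSpecialParts array

open DPPWithoutSpecialParts public using (array)

DPPSetoid : ℕ → Setoid 0ℓ 0ℓ
DPPSetoid m = On.setoid (setoid Array) (array {m})

multiplicity : ℕ → Array → ℕ
multiplicity v π = List.length (filter (ℕ._≟ v) (parts π))

-- Letters of words of length m - 1 are indexed from zero: index i stands for
-- the letter numbered toℕ i + 1, so m - (toℕ i + 1) + 1 = m ∸ toℕ i.

Word : ℕ → Set
Word m = Fin (m ∸ 1) → ℕ

multiplicityWord : (m : ℕ) → Array → Word m
multiplicityWord m π i = multiplicity (m ∸ toℕ i) π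

IsBounded : (m : ℕ) → Word m → Set
IsBounded m a = ∀ i → a i ≤ m ∸ suc (toℕ i)

BoundedWord : ℕ → Set
BoundedWord m = Σ[ a ∈ Word m ] IsBounded m a

BoundedWordSetoid : ℕ → Setoid 0ℓ 0ℓ
BoundedWordSetoid m = On.setoid (Fin (m ∸ 1) →-setoid ℕ) (proj₁ {B = IsBounded m})

-- Permutations of {1, …, m} are represented on Fin m, with x standing for
-- toℕ x + 1.

PermutationSetoid : ℕ → Setoid 0ℓ 0ℓ
PermutationSetoid m = On.setoid (Fin m →-setoid Fin m) (_⟨$⟩ʳ_ {m} {m})

inversions : ∀ {m} → Permutation′ m → List (Fin m × Fin m)
inversions {m} σ =
  filter (λ (i , j) → (i Fin.<? j) ×-dec ((σ ⟨$⟩ʳ j) Fin.<? (σ ⟨$⟩ʳ i)))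
         (cartesianProduct (allFin m) (allFin m))

inversionWord : ∀ {m} → Permutation′ m → Word m
inversionWord σ k =
  List.length (filter (λ (i , j) → toℕ (σ ⟨$⟩ʳ j) ℕ.≟ toℕ k) (inversions σ))

Matrix : ℕ → Set
Matrix m = Fin m → Fin m → ℕ

permutationMatrix : ∀ {m} → Permutation′ m → Matrix m
permutationMatrix σ i j = if does ((σ ⟨$⟩ʳ j) Fin.≟ i) then 1 else 0

IsPermutationMatrix : ∀ {m} → Matrix m → Set
IsPermutationMatrix {m} M =
  Σ[ σ ∈ Permutation′ m ] (∀ i j → M i j ≡ permutationMatrix σ i j)

PermutationMatrix : ℕ → Set
PermutationMatrix m = Σ[ M ∈ Matrix m ] IsPermutationMatrix M

PermutationMatrixSetoid : ℕ → Setoid 0ℓ 0ℓ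
PermutationMatrixSetoid m =
  On.setoid ((Fin m × Fin m) →-setoid ℕ)
            (λ (M : PermutationMatrix m) → uncurry (proj₁ M))

{-# OPTIONS --safe #-}

-- In a descending plane partition without special parts, every entry of a row
-- is at least the length L of the row, while the first entry of the next row
-- is at most L. So the parts, read row by row, form a weakly decreasing word,
-- and each row is cut off from it by the side of the Durfee square of what
-- remains. Conversely, if every v ≥ 1 occurs less than v times in a weakly
-- decreasing word, cutting it in this way yields a descending plane partition:
-- an equality a_{i,j} = a_{i+1,j} would need L parts equal to L.
-- For permutations, deleting the minimum gives a recursion both for the
-- inversion word and for the number of inversions.

module Submission where

open import Defs
open import Data.Nat.Base
open import Data.Nat.Properties
open import Algebra.Properties.CommutativeMonoid.Sum +-0-commutativeMonoid
  using (sum; sum-remove; sum-cong-≗; sum-replicate-zero; ∑-comm)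
open import Data.Bool.Base using (true; false; if_then_else_)
open import Data.Fin.Base as Fin using (Fin; zero; suc; toℕ; fromℕ<; inject₁; punchIn; punchOut)
import Data.Fin.Properties as Fin
open import Data.Fin.Permutation
  using (Permutation′; _≈_; _⟨$⟩ʳ_; _⟨$⟩ˡ_; inverseˡ; inverseʳ; remove; insert; remove-insert; punchIn-permute′)
  renaming (id to idₚ)
open import Data.List.Base
  using (List; []; _∷_; _++_; length; lookup; filter; replicate; tabulate; map; allFin; cartesianProduct)
open import Data.List.Membership.Propositional.Properties using (∈-lookup)
open import Data.List.NonEmpty.Base as List⁺ using (_∷_; toList)
open import Data.List.Properties
  using (length-++; length-replicate; length-filter; filter-++; filter-accept; filter-reject;
         filter-all; filter-none; map-tabulate; ∷-injective)
open import Data.List.Relation.Unary.All as All using (All; []; _∷_)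
import Data.List.Relation.Unary.All.Properties as All
open import Data.List.Relation.Unary.AllPairs using (AllPairs; []; _∷_)
import Data.List.Relation.Unary.AllPairs.Properties as AllPairs
open import Data.List.Relation.Unary.Linked as Linked using (Linked; []; [-]; _∷_)
open import Data.List.Relation.Unary.Linked.Properties using (AllPairs⇒Linked; Linked⇒AllPairs)
open import Data.Product.Base using (Σ-syntax; ∃-syntax; _×_; _,_; proj₁; proj₂)
open import Data.Sum.Base using (inj₁; inj₂)
open import Function.Base using (_∘_; flip; id)
open import Function.Bundles using (Bijection; mk⇔)
open import Relation.Binary.Definitions using (tri<; tri≈; tri>)
open import Relation.Binary.PropositionalEquality
open import Relation.Nullary.Decidable
  using (Dec; does; yes; no; _×-dec_; does-⇔; dec-true; dec-false)
open import Relation.Nullary.Negation using (¬_; contradiction)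
open import Relation.Unary using (Decidable)

-- Decreasing words and the number of occurrences of a value

Decreasing : List ℕ → Set
Decreasing = AllPairs _≥_

count : ℕ → List ℕ → ℕ
count v = length ∘ filter (_≟ v)

count-++ : ∀ v xs ys → count v (xs ++ ys) ≡ count v xs + count v ys
count-++ v xs ys = trans (cong length (filter-++ (_≟ v) xs ys)) (length-++ (filter (_≟ v) xs))

count-here : ∀ {v x} xs → x ≡ v → count v (x ∷ xs) ≡ suc (count v xs)
count-here {v} xs x≡v = cong length (filter-accept (_≟ v) x≡v)

count-there : ∀ {v x} xs → x ≢ v → count v (x ∷ xs) ≡ count v xs
count-there {v} xs x≢v = cong length (filter-reject (_≟ v) x≢v)

count-∷-≤ : ∀ v x xs → count v xs ≤ count v (x ∷ xs)
count-∷-≤ v x xs with x ≟ v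
... | yes x≡v = ≤-trans (n≤1+n _) (≤-reflexive (sym (count-here xs x≡v)))
... | no  x≢v = ≤-reflexive (sym (count-there xs x≢v))

count-≤-length : ∀ v xs → count v xs ≤ length xs
count-≤-length v = length-filter (_≟ v)

count-all : ∀ {v xs} → All (_≡ v) xs → count v xs ≡ length xs
count-all {v} = cong length ∘ filter-all (_≟ v)

count-none : ∀ {v xs} → All (_≢ v) xs → count v xs ≡ 0
count-none {v} = cong length ∘ filter-none (_≟ v)

count-none-< : ∀ {v xs} → All (_< v) xs → count v xs ≡ 0
count-none-< = count-none ∘ All.map <⇒≢

count-none-> : ∀ {v xs} → All (v <_) xs → count v xs ≡ 0
count-none-> = count-none ∘ All.map >⇒≢

decreasing-++⁻ : ∀ xs {ys} → Decreasing (xs ++ ys) → Decreasing xs × Decreasing ys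
decreasing-++⁻ []       d       = [] , d
decreasing-++⁻ (x ∷ xs) (p ∷ d) with decreasing-++⁻ xs d
... | dx , dy = All.++⁻ˡ xs p ∷ dx , dy

count-head≢0 : ∀ x xs → count x (x ∷ xs) ≢ 0
count-head≢0 x xs eq = contradiction (trans (sym (count-here {x} xs refl)) eq) λ ()

-- A larger first letter would be missing from the other word, so the first letters agree and can be
-- removed from both.
decreasing-count-injective : ∀ {xs ys} → Decreasing xs → Decreasing ys →
                             (∀ v → count v xs ≡ count v ys) → xs ≡ ys
decreasing-count-injective {[]} {[]} _ _ _ = refl
decreasing-count-injective {[]} {y ∷ ys} _ _ eq = contradiction (sym (eq y)) (count-head≢0 y ys)
decreasing-count-injective {x ∷ xs} {[]} _ _ eq = contradiction (eq x) (count-head≢0 x xs)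
decreasing-count-injective {x ∷ xs} {y ∷ ys} (px ∷ dx) (py ∷ dy) eq with <-cmp x y
... | tri< x<y _ _ = contradiction
  (trans (sym (eq y)) (count-none-< (x<y ∷ All.map (λ z≤x → ≤-<-trans z≤x x<y) px)))
  (count-head≢0 y ys)
... | tri> _ _ y<x = contradiction
  (trans (eq x) (count-none-< (y<x ∷ All.map (λ z≤y → ≤-<-trans z≤y y<x) py)))
  (count-head≢0 x xs)
... | tri≈ _ refl _ = cong (x ∷_) (decreasing-count-injective dx dy tails)
  where
  tails : ∀ v → count v xs ≡ count v ys
  tails v with x ≟ v
  ... | yes p = suc-injective (trans (sym (count-here xs p)) (trans (eq v) (count-here ys p)))
  ... | no ¬p = trans (sym (count-there xs ¬p)) (trans (eq v) (count-there ys ¬p))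

-- Cutting a decreasing word into rows

private
  shift : ∀ (P : ℕ → Set) {k l} → P (k + suc l) → P (suc k + l)
  shift P {k} {l} = subst P (+-suc k l)

  unshift : ∀ (P : ℕ → Set) {k l} → P (suc k + l) → P (k + suc l)
  unshift P {k} {l} = subst P (sym (+-suc k l))

-- The common induction step of `durfee` and `noSpecial⇒≥length`: for nonempty `xs`, the letter `x`
-- inherits the bound from its successor.
head-≥-shifted-length : ∀ {k x xs} → k < x → All (x ≥_) xs →
  All (suc k + length xs ≤_) xs → suc k + length xs ≤ x
head-≥-shifted-length {k} {x} {[]}     k<x _         _       = subst (_≤ x) (sym (+-identityʳ (suc k))) k<x
head-≥-shifted-length {xs = _ ∷ _} _ (y≤x ∷ _) (l≤y ∷ _) = ≤-trans l≤y y≤x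

-- The offset k makes the search for the side of the Durfee square of xs
-- (the case k = 0) structurally recursive.
durfee : ∀ k xs → Decreasing xs →
  ∃[ ys ] ∃[ zs ] ys ++ zs ≡ xs × All (k + length ys ≤_) ys × All (_≤ k + length ys) zs
durfee k [] _ = [] , [] , refl , [] , []
durfee k (x ∷ xs) (px ∷ dx) with x ≤? k
... | yes x≤k = [] , x ∷ xs , refl , [] ,
  subst (λ n → All (_≤ n) (x ∷ xs)) (sym (+-identityʳ k)) (x≤k ∷ All.map (flip ≤-trans x≤k) px)
... | no x≰k with durfee (suc k) xs dx
... | ys , zs , refl , ≥L , ≤L =
  x ∷ ys , zs , refl
  , unshift (λ n → All (n ≤_) (x ∷ ys))
      (head-≥-shifted-length (≰⇒> x≰k) (All.++⁻ˡ ys px) ≥L ∷ ≥L)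
  , unshift (λ n → All (_≤ n) zs) ≤L

-- If one prefix stopped before the other, the next letter would be at most the offset by one
-- factorization and above it by the other.
durfee-unique : ∀ k {xs xs′ ys ys′} → xs ++ ys ≡ xs′ ++ ys′ →
  All (k + length xs ≤_) xs → All (_≤ k + length xs) ys →
  All (k + length xs′ ≤_) xs′ → All (_≤ k + length xs′) ys′ →
  xs ≡ xs′ × ys ≡ ys′
durfee-unique k {[]} {[]} eq _ _ _ _ = refl , eq
durfee-unique k {[]} {x ∷ xs} refl _ (x≤k ∷ _) (k<x ∷ _) _ =
  contradiction (≤-trans k<x x≤k) (<⇒≱ (+-monoʳ-< k z<s))
durfee-unique k {x ∷ xs} {[]} refl (k<x ∷ _) _ _ (x≤k ∷ _) =
  contradiction (≤-trans k<x x≤k) (<⇒≱ (+-monoʳ-< k z<s))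
durfee-unique k {x ∷ xs} {x′ ∷ xs′} {ys} {ys′} eq (_ ∷ ≥L) ≤L (_ ∷ ≥L′) ≤L′
  with refl , eq′ ← ∷-injective eq
  with refl , refl ← durfee-unique (suc k) eq′
    (shift (λ n → All (n ≤_) xs) ≥L) (shift (λ n → All (_≤ n) ys) ≤L)
    (shift (λ n → All (n ≤_) xs′) ≥L′) (shift (λ n → All (_≤ n) ys′) ≤L′)
  = refl , refl

-- Each row is the Durfee prefix of the decreasing word formed by the parts in
-- it and in all later rows.
data DurfeeRows : Array → Set where
  []  : DurfeeRows []
  row : ∀ {r π} → Decreasing (toList r) → All (List⁺.length r ≤_) (toList r) →
        All (_≤ List⁺.length r) (parts π) → DurfeeRows π → DurfeeRows (r ∷ π)

durfeeRows-unique : ∀ {π ρ} → DurfeeRows π → DurfeeRows ρ → parts π ≡ parts ρ → π ≡ ρ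
durfeeRows-unique [] [] _ = refl
durfeeRows-unique (row {x ∷ xs} _ ≥L ≤L d) (row {y ∷ ys} _ ≥L′ ≤L′ d′) eq
  with refl , eq′ ← durfee-unique 0 {x ∷ xs} {y ∷ ys} eq ≥L ≤L ≥L′ ≤L′
  = cong ((x ∷ xs) ∷_) (durfeeRows-unique d d′ eq′)

-- Positivity makes every Durfee prefix nonempty, so each row shortens the word; `n` bounds its
-- length and carries the recursion.
durfeeRows-exists : ∀ n xs → length xs ≤ n → Decreasing xs → All (0 <_) xs →
                    ∃[ π ] DurfeeRows π × parts π ≡ xs
durfeeRows-exists _ [] _ _ _ = [] , [] , refl
durfeeRows-exists (suc n) (x ∷ xs) (s≤s l≤n) d pos with durfee 0 (x ∷ xs) d
durfeeRows-exists (suc n) (x ∷ xs) (s≤s l≤n) d (0<x ∷ _)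
  | [] , zs , refl , _ , x≤0 ∷ _ = contradiction x≤0 (<⇒≱ 0<x)
durfeeRows-exists (suc n) (x ∷ xs) (s≤s l≤n) (p ∷ d) (_ ∷ pos)
  | .x ∷ ys , zs , refl , ≥L , ≤L
  with dys , dzs ← decreasing-++⁻ ys d
  with π , dπ , refl ← durfeeRows-exists n zs
         (≤-trans (m≤n+m _ (length ys)) (subst (_≤ n) (length-++ ys) l≤n)) dzs (All.++⁻ʳ ys pos)
  = (x ∷ ys) ∷ π , row (All.++⁻ˡ ys p ∷ dys) ≥L ≤L dπ , refl

-- The length of a row separates its entries from all later parts.
durfeeRows-decreasing : ∀ {π} → DurfeeRows π → Decreasing (parts π)
durfeeRows-decreasing []              = []
durfeeRows-decreasing (row dr ≥L ≤L d) =
  AllPairs.++⁺ dr (durfeeRows-decreasing d) (All.map (λ L≤x → All.map (flip ≤-trans L≤x) ≤L) ≥L)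

-- Rows of a descending plane partition without special parts

-- The last entry exceeds the number of entries to its left, so it is at least the row length, and
-- the other entries are no smaller. The offset `k` counts the entries already passed.
noSpecial⇒≥length : ∀ k {xs} → Decreasing xs → (∀ i → k + toℕ i < lookup xs i) →
                    All (k + length xs ≤_) xs
noSpecial⇒≥length k {[]} _ _ = []
noSpecial⇒≥length k {x ∷ xs} (p ∷ d) ns =
  unshift (λ n → All (n ≤_) (x ∷ xs))
    (head-≥-shifted-length (subst (_< x) (+-identityʳ k) (ns zero)) p ih ∷ ih)
  where
  ih = noSpecial⇒≥length (suc k) d (λ i → shift (_< lookup xs i) (ns (suc i)))

≥length⇒noSpecial : ∀ {xs l} → All (l ≤_) xs → length xs ≤ l → ∀ i → toℕ i < lookup xs i
≥length⇒noSpecial ≥l len≤l i = <-≤-trans (Fin.toℕ<n i) (≤-trans len≤l (All.lookup ≥l (∈-lookup i)))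

open IsDescendingPlanePartition

isDPP-tail : ∀ {r π} → IsDescendingPlanePartition (r ∷ π) → IsDescendingPlanePartition π
isDPP-tail dpp = record
  { positive           = All.tail (positive dpp)
  ; rowsWeaklyDecrease = All.tail (rowsWeaklyDecrease dpp)
  ; columnsDecrease    = Linked.tail (columnsDecrease dpp)
  ; head>length        = All.tail (head>length dpp)
  ; head≤prevLength    = Linked.tail (head≤prevLength dpp)
  }

isDPP⇒durfeeRows : ∀ {π} → IsDescendingPlanePartition π → NoSpecialParts π → DurfeeRows π
isDPP⇒durfeeRows {[]} _ _ = []
isDPP⇒durfeeRows {(x ∷ xs) ∷ π} dpp (ns ∷ nss) =
  row dr (noSpecial⇒≥length 0 dr (λ i → ≰⇒> (ns i))) (later (head≤prevLength dpp) ih) ih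
  where
  dr = Linked⇒AllPairs (flip ≤-trans) (All.head (rowsWeaklyDecrease dpp))
  ih = isDPP⇒durfeeRows (isDPP-tail dpp) nss
  later : ∀ {r π} → Linked (λ r s → List⁺.head s ≤ List⁺.length r) (r ∷ π) → DurfeeRows π →
          All (_≤ List⁺.length r) (parts π)
  later {π = []}           _         _ = []
  -- The later parts form a decreasing word, so the bound on its first letter suffices.
  later {π = (_ ∷ _) ∷ _} (y≤L ∷ _) d with ps ∷ _ ← durfeeRows-decreasing d =
    y≤L ∷ All.map (flip ≤-trans y≤L) ps

durfeeRows⇒noSpecial : ∀ {π} → DurfeeRows π → NoSpecialParts π
durfeeRows⇒noSpecial [] = []
durfeeRows⇒noSpecial (row {x ∷ xs} _ ≥L _ d) =
  (λ i → <⇒≱ (≥length⇒noSpecial ≥L ≤-refl i)) ∷ durfeeRows⇒noSpecial d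

-- Pairing the i-th entry of xs with the i-th entry of ys, at most one of the
-- two is equal to v.
strict-columns⇒count : ∀ v xs ys → length ys ≤ length xs →
  (∀ p q → toℕ q ≡ toℕ p → lookup xs q > lookup ys p) →
  count v xs + count v ys ≤ length xs
strict-columns⇒count v xs [] _ _ =
  subst (_≤ length xs) (sym (+-identityʳ _)) (count-≤-length v xs)
strict-columns⇒count v (x ∷ xs) (y ∷ ys) (s≤s l) col
  with ih ← strict-columns⇒count v xs ys l (λ p q e → col (suc p) (suc q) (cong suc e))
  with x ≟ v | y ≟ v
... | yes refl | yes refl = contradiction (col zero zero refl) (<-irrefl refl)
... | yes x≡v  | no y≢v   rewrite count-here xs x≡v | count-there ys y≢v = s≤s ih
... | no x≢v   | no y≢v   rewrite count-there xs x≢v | count-there ys y≢v = m≤n⇒m≤1+n ih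
... | no x≢v   | yes y≡v  rewrite count-there xs x≢v | count-here ys y≡v | +-suc (count v xs) (count v ys) = s≤s ih

-- As `v` separates the two rows, the failing column consists of two copies of `v`. Then `xs` equals
-- `v` from there on and `ys` equals `v` up to there, which makes at least one copy more than
-- `length xs`.
weak-column⇒count : ∀ {v xs ys} → Decreasing xs → Decreasing ys →
  All (v ≤_) xs → All (_≤ v) ys → ∀ p q → toℕ q ≡ toℕ p → lookup xs q ≤ lookup ys p →
  length xs < count v xs + count v ys
weak-column⇒count {v} {x ∷ xs} {y ∷ ys} (px ∷ _) _ (v≤x ∷ ≥v) (y≤v ∷ _) zero zero _ x≤y
  with refl ← ≤-antisym v≤x (≤-trans x≤y y≤v)
  with refl ← ≤-antisym y≤v x≤y
  rewrite count-all (refl {x = v} ∷ All.zipWith (λ (a , b) → ≤-antisym a b) (px , ≥v))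
        | count-here ys (refl {x = v}) = m<m+n _ z<s
weak-column⇒count {v} {x ∷ xs} {y ∷ ys} (_ ∷ dx) (py ∷ dy) (_ ∷ ≥v) (y≤v ∷ ≤v) (suc p) (suc q) e x≤y
  rewrite count-here ys (≤-antisym y≤v
            (≤-trans (All.lookup ≥v (∈-lookup q)) (≤-trans x≤y (All.lookup py (∈-lookup p)))))
        | +-suc (count v (x ∷ xs)) (count v ys)
  = s≤s (≤-trans
      (weak-column⇒count dx dy ≥v ≤v p q (suc-injective e) x≤y)
      (+-monoˡ-≤ (count v ys) (count-∷-≤ v x xs)))

-- The parts equal to v < length r are all in later rows, and the parts equal
-- to v > length r are all in r. Parts equal to length r occur in r and in at
-- most the next row s, where strictness of the columns bounds their number.
isDPP⇒count< : ∀ {π} → IsDescendingPlanePartition π → DurfeeRows π →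
               ∀ {v} → 0 < v → count v (parts π) < v
isDPP⇒count< {[]} _ _ 0<v = 0<v
isDPP⇒count< {r@(x ∷ xs) ∷ π} dpp (row dr ≥L ≤L d) {v} 0<v
  rewrite count-++ v (x ∷ xs) (parts π)
  with <-cmp v (List⁺.length r)
... | tri< v<L _ _
  rewrite count-none-> (All.map (<-≤-trans v<L) ≥L) = isDPP⇒count< (isDPP-tail dpp) d 0<v
... | tri> _ _ L<v
  rewrite count-none-< (All.map (λ y≤L → ≤-<-trans y≤L L<v) ≤L)
        | +-identityʳ (count v (x ∷ xs)) = ≤-<-trans (count-≤-length v (x ∷ xs)) L<v
... | tri≈ _ refl _
  -- The first entry exceeds the row length `v`, so only `xs`, one entry shorter than the row, can
  -- contribute.
  rewrite count-there xs (>⇒≢ (All.head (head>length dpp))) = s≤s (next dpp d ≤L)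
  where
  next : ∀ {π} → IsDescendingPlanePartition (r ∷ π) → DurfeeRows π → All (_≤ v) (parts π) →
         count v xs + count v (parts π) ≤ length xs
  next {[]} _ _ _ = subst (_≤ length xs) (sym (+-identityʳ _)) (count-≤-length v xs)
  next {(y ∷ ys) ∷ ρ} dpp (row _ _ ≤ls _) (y≤v ∷ _)
    with ls<y ← All.head (All.tail (head>length dpp))
    rewrite count-++ v (y ∷ ys) (parts ρ)
          | count-none-< (All.map (λ z≤ls → ≤-<-trans z≤ls (<-≤-trans ls<y y≤v)) ≤ls)
          | +-identityʳ (count v (y ∷ ys))
    -- Each row is shifted by one against the previous row, so dropping the first entry of `r`
    -- aligns the columns.
    = strict-columns⇒count v xs (y ∷ ys) (≤-pred (≤-trans ls<y y≤v))
        (λ p q e → Linked.head (columnsDecrease dpp) p (suc q) (cong suc e))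

-- From Durfee rows back to descending plane partitions

linked-∷ : ∀ {A : Set} {R : A → A → Set} {x xs} →
           (∀ {y ys} → xs ≡ y ∷ ys → R x y) → Linked R xs → Linked R (x ∷ xs)
linked-∷ {xs = []}    _ _ = [-]
linked-∷ {xs = _ ∷ _} h l = h refl ∷ l

durfeeRows⇒isDPP : ∀ {π} → DurfeeRows π → All (0 <_) (parts π) →
                   (∀ {v} → 0 < v → count v (parts π) < v) → IsDescendingPlanePartition π
durfeeRows⇒isDPP [] _ _ = record
  { positive = [] ; rowsWeaklyDecrease = [] ; columnsDecrease = [] ; head>length = [] ; head≤prevLength = [] }
durfeeRows⇒isDPP {r@(x ∷ xs) ∷ π} (row dr@(px ∷ dxs) ≥L@(_ ∷ ≥L′) ≤L d) pos count< = record
  { positive           = All.++⁻ˡ (x ∷ xs) pos ∷ positive ih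
  ; rowsWeaklyDecrease = AllPairs⇒Linked dr ∷ rowsWeaklyDecrease ih
  ; columnsDecrease    = linked-∷ columns (columnsDecrease ih)
  ; head>length        = L<x ∷ head>length ih
  ; head≤prevLength    = linked-∷ (λ { refl → All.head ≤L }) (head≤prevLength ih)
  }
  where
  L = List⁺.length r

  split : ∀ v → count v (parts (r ∷ π)) ≡ count v (x ∷ xs) + count v (parts π)
  split v = count-++ v (x ∷ xs) (parts π)

  countL< : count L (x ∷ xs) + count L (parts π) < L
  countL< = subst (_< L) (split L) (count< z<s)

  ih = durfeeRows⇒isDPP d (All.++⁻ʳ (x ∷ xs) pos)
         (λ {v} 0<v → ≤-<-trans (subst (count v (parts π) ≤_) (sym (split v)) (m≤n+m _ _)) (count< 0<v))

  L<x : L < x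
  -- If `x ≤ L`, then all `L` entries of the row are squeezed to `L`.
  L<x = ≰⇒> λ x≤L → <⇒≱ (≤-<-trans (m≤m+n _ _) countL<) (≤-reflexive (sym (count-all
    (All.zipWith (λ (z≤x , L≤z) → ≤-antisym (≤-trans z≤x x≤L) L≤z) (≤-refl ∷ px , ≥L)))))

  columns : ∀ {s ρ} → π ≡ s ∷ ρ → ColumnsDecrease r s
  -- A failing column yields more than `length xs`, that is, at least `L` parts equal to `L`.
  columns {y ∷ ys} {ρ} refl p (suc q) e = ≰⇒> λ x≤y → <⇒≱ countL< (≤-trans
    (weak-column⇒count dxs (proj₁ (decreasing-++⁻ (y ∷ ys) (durfeeRows-decreasing d)))
      ≥L′ (All.++⁻ˡ (y ∷ ys) ≤L) p q (suc-injective e) x≤y)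
    (+-mono-≤ (count-∷-≤ L x xs)
      (subst (count L (y ∷ ys) ≤_) (sym (count-++ L (y ∷ ys) (parts ρ))) (m≤m+n _ _))))

-- Decreasing words and their multiplicities

-- With n = m - 1, the letters count the values m, m - 1, ..., 2 in this order. The value 1 has no
-- letter, as it is never a part.
fromMultiplicities : ∀ n → (Fin n → ℕ) → List ℕ
fromMultiplicities zero    a = []
fromMultiplicities (suc n) a = replicate (a zero) (suc (suc n)) ++ fromMultiplicities n (a ∘ suc)

fromMultiplicities-≤ : ∀ n a → All (_≤ suc n) (fromMultiplicities n a)
fromMultiplicities-≤ zero    a = []
fromMultiplicities-≤ (suc n) a =
  All.++⁺ (All.replicate⁺ (a zero) ≤-refl) (All.map m≤n⇒m≤1+n (fromMultiplicities-≤ n (a ∘ suc)))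

fromMultiplicities-≥2 : ∀ n a → All (2 ≤_) (fromMultiplicities n a)
fromMultiplicities-≥2 zero    a = []
fromMultiplicities-≥2 (suc n) a =
  All.++⁺ (All.replicate⁺ (a zero) (s≤s (s≤s z≤n))) (fromMultiplicities-≥2 n (a ∘ suc))

decreasing-replicate : ∀ n x → Decreasing (replicate n x)
decreasing-replicate zero    x = []
decreasing-replicate (suc n) x = All.replicate⁺ n ≤-refl ∷ decreasing-replicate n x

fromMultiplicities-decreasing : ∀ n a → Decreasing (fromMultiplicities n a)
fromMultiplicities-decreasing zero    a = []
fromMultiplicities-decreasing (suc n) a =
  AllPairs.++⁺ (decreasing-replicate (a zero) _) (fromMultiplicities-decreasing n (a ∘ suc))
    (All.replicate⁺ (a zero) (All.map m≤n⇒m≤1+n (fromMultiplicities-≤ n (a ∘ suc))))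

count-fromMultiplicities-top : ∀ n a → count (2 + n) (fromMultiplicities (suc n) a) ≡ a zero
count-fromMultiplicities-top n a
  rewrite count-++ (2 + n) (replicate (a zero) (2 + n)) (fromMultiplicities n (a ∘ suc))
        | count-none-< (All.map s≤s (fromMultiplicities-≤ n (a ∘ suc)))
        | count-all (All.replicate⁺ {P = _≡ 2 + n} (a zero) refl)
        | length-replicate (a zero) {2 + n} = +-identityʳ _

count-fromMultiplicities-below : ∀ n a {v} → v ≢ 2 + n →
  count v (fromMultiplicities (suc n) a) ≡ count v (fromMultiplicities n (a ∘ suc))
count-fromMultiplicities-below n a {v} v≢
  rewrite count-++ v (replicate (a zero) (2 + n)) (fromMultiplicities n (a ∘ suc))
        | count-none (All.replicate⁺ {P = _≢ v} (a zero) (v≢ ∘ sym)) = refl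

count-fromMultiplicities : ∀ n a i → count (suc n ∸ toℕ i) (fromMultiplicities n a) ≡ a i
count-fromMultiplicities (suc n) a zero    = count-fromMultiplicities-top n a
count-fromMultiplicities (suc n) a (suc i) = trans
  (count-fromMultiplicities-below n a (<⇒≢ (s≤s (m∸n≤m (suc n) (toℕ i)))))
  (count-fromMultiplicities n (a ∘ suc) i)

-- The letter that counts the value v is bounded by v - 1; positive values without a letter do not
-- occur.
count-fromMultiplicities-< : ∀ n a → (∀ i → a i ≤ n ∸ toℕ i) → ∀ {v} → 0 < v →
                             count v (fromMultiplicities n a) < v
count-fromMultiplicities-< zero    a b 0<v = 0<v
count-fromMultiplicities-< (suc n) a b {v} 0<v with v ≟ 2 + n
... | yes refl rewrite count-fromMultiplicities-top n a = s≤s (b zero)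
... | no v≢ rewrite count-fromMultiplicities-below n a v≢ =
  count-fromMultiplicities-< n (a ∘ suc) (b ∘ suc) 0<v

∸-surjective : ∀ {n v} → 2 ≤ v → v ≤ suc n → Σ[ i ∈ Fin n ] suc n ∸ toℕ i ≡ v
∸-surjective {zero}  2≤v v≤1 = contradiction (≤-trans 2≤v v≤1) (<⇒≱ ≤-refl)
∸-surjective {suc n} 2≤v v≤ with m≤n⇒m<n∨m≡n v≤
... | inj₂ refl = zero , refl
... | inj₁ (s≤s v≤n) with i , e ← ∸-surjective 2≤v v≤n = suc i , e

length-fromMultiplicities : ∀ n a → length (fromMultiplicities n a) ≡ sum a
length-fromMultiplicities zero    a = refl
length-fromMultiplicities (suc n) a = trans (length-++ (replicate (a zero) (2 + n)))
  (cong₂ _+_ (length-replicate (a zero)) (length-fromMultiplicities n (a ∘ suc)))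

-- The letters fix the counts of 2, ..., n + 1, and all other values are absent from both words.
decreasing⇒fromMultiplicities : ∀ n {xs} a → Decreasing xs → All (2 ≤_) xs → All (_≤ suc n) xs →
  (∀ i → count (suc n ∸ toℕ i) xs ≡ a i) → xs ≡ fromMultiplicities n a
decreasing⇒fromMultiplicities n {xs} a d ≥2 ≤n eq =
  decreasing-count-injective d (fromMultiplicities-decreasing n a) same
  where
  same : ∀ v → count v xs ≡ count v (fromMultiplicities n a)
  same v with 2 ≤? v | v ≤? suc n
  ... | no 2≰v | _ = trans
    (count-none-> (All.map (<-≤-trans (≰⇒> 2≰v)) ≥2))
    (sym (count-none-> (All.map (<-≤-trans (≰⇒> 2≰v)) (fromMultiplicities-≥2 n a))))
  ... | yes _ | no v≰n = trans
    (count-none-< (All.map (λ x≤ → ≤-<-trans x≤ (≰⇒> v≰n)) ≤n))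
    (sym (count-none-< (All.map (λ x≤ → ≤-<-trans x≤ (≰⇒> v≰n)) (fromMultiplicities-≤ n a))))
  ... | yes 2≤v | yes v≤n with i , refl ← ∸-surjective {n} 2≤v v≤n =
    trans (eq i) (sym (count-fromMultiplicities n a i))

fromMultiplicities-cong : ∀ n {a b} → a ≗ b → fromMultiplicities n a ≡ fromMultiplicities n b
fromMultiplicities-cong zero    _  = refl
fromMultiplicities-cong (suc n) eq =
  cong₂ _++_ (cong (λ k → replicate k (2 + n)) (eq zero)) (fromMultiplicities-cong n (eq ∘ suc))

-- The entry of a one-element row exceeds the length 1, and in a longer row every entry is at least
-- the length.
isDPP⇒parts≥2 : ∀ {π} → IsDescendingPlanePartition π → DurfeeRows π → All (2 ≤_) (parts π)
isDPP⇒parts≥2 {[]} _ _ = []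
isDPP⇒parts≥2 {(x ∷ xs) ∷ π} dpp (row _ ≥L _ d) =
  All.++⁺ (row≥2 (All.head (head>length dpp)) ≥L) (isDPP⇒parts≥2 (isDPP-tail dpp) d)
  where
  row≥2 : ∀ {x xs} → suc (length xs) < x → All (suc (length xs) ≤_) (x ∷ xs) → All (2 ≤_) (x ∷ xs)
  row≥2 {xs = []}    1<x _  = 1<x ∷ []
  row≥2 {xs = _ ∷ _} _   ≥L = All.map (≤-trans (s≤s (s≤s z≤n))) ≥L

-- Counting by sums of indicators

𝟙 : ∀ {P : Set} → Dec P → ℕ
𝟙 p? = if does p? then 1 else 0

𝟙-cong : ∀ {P Q : Set} (p? : Dec P) (q? : Dec Q) → (P → Q) → (Q → P) → 𝟙 p? ≡ 𝟙 q?
𝟙-cong p? q? f g = cong (if_then 1 else 0) (does-⇔ (mk⇔ f g) p? q?)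

𝟙-false : ∀ {P : Set} (p? : Dec P) → ¬ P → 𝟙 p? ≡ 0
𝟙-false p? ¬p = cong (if_then 1 else 0) (dec-false p? ¬p)

module _ {A : Set} {P : A → Set} (P? : Decidable P) where

  length-filter-∷ : ∀ x xs → length (filter P? (x ∷ xs)) ≡ 𝟙 (P? x) + length (filter P? xs)
  length-filter-∷ x xs with does (P? x)
  ... | true  = refl
  ... | false = refl

  length-filter-tabulate : ∀ {n} (f : Fin n → A) →
    length (filter P? (tabulate f)) ≡ sum (λ i → 𝟙 (P? (f i)))
  length-filter-tabulate {zero}  f = refl
  length-filter-tabulate {suc n} f = trans (length-filter-∷ (f zero) _)
    (cong (𝟙 (P? (f zero)) +_) (length-filter-tabulate (f ∘ suc)))

  filter-filter : ∀ {Q : A → Set} (Q? : Decidable Q) xs →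
    filter Q? (filter P? xs) ≡ filter (λ x → P? x ×-dec Q? x) xs
  filter-filter Q? [] = refl
  filter-filter Q? (x ∷ xs) with does (P? x)
  ... | false = filter-filter Q? xs
  ... | true with does (Q? x)
  ...   | false = filter-filter Q? xs
  ...   | true  = cong (x ∷_) (filter-filter Q? xs)

length-filter-cartesianProduct : ∀ {A B : Set} {P : A × B → Set} (P? : Decidable P)
  {m n} (f : Fin m → A) (g : Fin n → B) →
  length (filter P? (cartesianProduct (tabulate f) (tabulate g)))
    ≡ sum (λ i → sum (λ j → 𝟙 (P? (f i , g j))))
length-filter-cartesianProduct P? {zero}  f g = refl
length-filter-cartesianProduct P? {suc m} f g = begin
  length (filter P? (map (f zero ,_) (tabulate g) ++ rest))
    ≡⟨ cong length (filter-++ P? (map (f zero ,_) (tabulate g)) rest) ⟩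
  length (filter P? (map (f zero ,_) (tabulate g)) ++ filter P? rest)
    ≡⟨ length-++ (filter P? (map (f zero ,_) (tabulate g))) ⟩
  length (filter P? (map (f zero ,_) (tabulate g))) + length (filter P? rest)
    ≡⟨ cong₂ _+_
         (trans (cong (length ∘ filter P?) (map-tabulate g (f zero ,_)))
                (length-filter-tabulate P? ((f zero ,_) ∘ g)))
         (length-filter-cartesianProduct P? (f ∘ suc) g) ⟩
  sum (λ i → sum (λ j → 𝟙 (P? (f i , g j)))) ∎
  where
  open ≡-Reasoning
  rest = cartesianProduct (tabulate (f ∘ suc)) (tabulate g)

sum-zero : ∀ {n} (f : Fin n → ℕ) → (∀ i → f i ≡ 0) → sum f ≡ 0
sum-zero {n} f f≡0 = trans (sum-cong-≗ f≡0) (sum-replicate-zero n)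

sum-single : ∀ {n} (f : Fin n → ℕ) c → (∀ i → i ≢ c → f i ≡ 0) → sum f ≡ f c
sum-single {suc n} f c f≡0 = begin
  sum f                                ≡⟨ sum-remove {i = c} f ⟩
  f c + sum (λ i → f (punchIn c i))    ≡⟨ cong (f c +_) (sum-zero _ (λ i → f≡0 _ (Fin.punchInᵢ≢i c i))) ⟩
  f c + 0                              ≡⟨ +-identityʳ (f c) ⟩
  f c                                  ∎
  where open ≡-Reasoning

sum-𝟙-< : ∀ {n} (c : Fin n) → sum {n} (λ i → 𝟙 (i Fin.<? c)) ≡ toℕ c
sum-𝟙-< {suc n} zero    = sum-replicate-zero n
sum-𝟙-< {suc n} (suc c) = cong suc (sum-𝟙-< c)

-- Inversions

inversion? : ∀ {m} (σ : Permutation′ m) (i j : Fin m) →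
             Dec (i Fin.< j × (σ ⟨$⟩ʳ j) Fin.< (σ ⟨$⟩ʳ i))
inversion? σ i j = (i Fin.<? j) ×-dec ((σ ⟨$⟩ʳ j) Fin.<? (σ ⟨$⟩ʳ i))

inversionsAt : ∀ {m} → Permutation′ m → Fin m → ℕ
inversionsAt σ j = sum (λ i → 𝟙 (inversion? σ i j))

length-inversions : ∀ {m} (σ : Permutation′ m) → length (inversions σ) ≡ sum (inversionsAt σ)
length-inversions σ = trans
  (length-filter-cartesianProduct (λ (i , j) → inversion? σ i j) id id)
  (∑-comm (λ i j → 𝟙 (inversion? σ i j)))

-- After the sums are exchanged, only the position holding the value `l` contributes. Here `l` is
-- the letter index `k` read as a value of `σ`.
inversionWord≡inversionsAt : ∀ {m} (σ : Permutation′ m) k (l : Fin m) → toℕ l ≡ toℕ k →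
                             inversionWord σ k ≡ inversionsAt σ (σ ⟨$⟩ˡ l)
inversionWord≡inversionsAt {m} σ k l l≡k = begin
  inversionWord σ k
    ≡⟨ cong length (filter-filter (λ (i , j) → inversion? σ i j) (λ (_ , j) → value? j) pairs) ⟩
  length (filter (λ (i , j) → inversion? σ i j ×-dec value? j) pairs)
    ≡⟨ length-filter-cartesianProduct (λ (i , j) → inversion? σ i j ×-dec value? j) id id ⟩
  sum (λ i → sum (λ j → 𝟙 (inversion? σ i j ×-dec value? j)))
    ≡⟨ ∑-comm (λ i j → 𝟙 (inversion? σ i j ×-dec value? j)) ⟩
  sum (λ j → sum (λ i → 𝟙 (inversion? σ i j ×-dec value? j)))
    ≡⟨ sum-single _ c (λ j j≢c → sum-zero _ (λ i →
         𝟙-false (inversion? σ i j ×-dec value? j) (j≢c ∘ unique ∘ proj₂))) ⟩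
  sum (λ i → 𝟙 (inversion? σ i c ×-dec value? c))
    ≡⟨ sum-cong-≗ (λ i → 𝟙-cong (inversion? σ i c ×-dec value? c) (inversion? σ i c) proj₁
         (_, trans (cong toℕ (inverseʳ σ)) l≡k)) ⟩
  inversionsAt σ c ∎
  where
  open ≡-Reasoning
  pairs = cartesianProduct (allFin m) (allFin m)
  c = σ ⟨$⟩ˡ l
  value? : ∀ j → Dec (toℕ (σ ⟨$⟩ʳ j) ≡ toℕ k)
  value? j = toℕ (σ ⟨$⟩ʳ j) ≟ toℕ k
  unique : ∀ {j} → toℕ (σ ⟨$⟩ʳ j) ≡ toℕ k → j ≡ c
  unique e = trans (sym (inverseˡ σ)) (cong (σ ⟨$⟩ˡ_) (Fin.toℕ-injective (trans e (sym l≡k))))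

-- Deleting the minimum of a permutation

module RemoveMinimum {n} (σ : Permutation′ (2 + n)) where

  position : Fin (2 + n)
  position = σ ⟨$⟩ˡ zero

  rest : Permutation′ (suc n)
  rest = remove position σ

  at-position : σ ⟨$⟩ʳ position ≡ zero
  at-position = inverseʳ σ

  off-position : ∀ j → σ ⟨$⟩ʳ punchIn position j ≡ suc (rest ⟨$⟩ʳ j)
  off-position = punchIn-permute′ σ zero

  from-suc : ∀ k → σ ⟨$⟩ˡ suc k ≡ punchIn position (rest ⟨$⟩ˡ k)
  from-suc k = trans
    (cong (σ ⟨$⟩ˡ_) (sym (trans (off-position _) (cong suc (inverseʳ rest)))))
    (inverseˡ σ)

  inversionsAt-position : inversionsAt σ position ≡ toℕ position
  inversionsAt-position = trans
    (sum-cong-≗ (λ i → 𝟙-cong (inversion? σ i position) (i Fin.<? position) proj₁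
      (λ i<c → i<c , subst (Fin._< (σ ⟨$⟩ʳ i)) (sym at-position) (value>0 i<c))))
    (sum-𝟙-< position)
    where
    value>0 : ∀ {i} → i Fin.< position → zero {suc n} Fin.< (σ ⟨$⟩ʳ i)
    value>0 {i} i<c = ≤∧≢⇒< z≤n λ 0≡σi → <⇒≢ i<c (cong toℕ
      (trans (sym (inverseˡ σ)) (cong (σ ⟨$⟩ˡ_) (sym (Fin.toℕ-injective 0≡σi)))))

  -- The minimum is never the larger entry of an inversion, and its deletion keeps the relative
  -- order of the other positions and values.
  inversionsAt-off-position : ∀ j → inversionsAt σ (punchIn position j) ≡ inversionsAt rest j
  inversionsAt-off-position j = trans
    (sum-remove {i = position} (λ i → 𝟙 (inversion? σ i (punchIn position j))))
    (cong₂ _+_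
      (𝟙-false (inversion? σ position (punchIn position j))
        (λ (_ , lt) → contradiction (subst ((σ ⟨$⟩ʳ punchIn position j) Fin.<_) at-position lt) λ ()))
      (sum-cong-≗ λ i → 𝟙-cong
        (inversion? σ (punchIn position i) (punchIn position j)) (inversion? rest i j)
        (λ (lt , gt) → ≰⇒> (<⇒≱ lt ∘ Fin.punchIn-mono-≤ position j i)
                     , s≤s⁻¹ (subst₂ Fin._<_ (off-position j) (off-position i) gt))
        (λ (lt , gt) → ≰⇒> (<⇒≱ lt ∘ Fin.punchIn-cancel-≤ position j i)
                     , subst₂ Fin._<_ (sym (off-position j)) (sym (off-position i)) (s≤s gt))))

-- The word (a₁, …, a_{m-1}) computed by deleting the minimum: all entries to
-- the left of the minimum are larger, and its deletion keeps the other aₖ.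
code : ∀ n → Permutation′ (suc n) → Fin n → ℕ
code (suc n) σ zero    = toℕ (RemoveMinimum.position σ)
code (suc n) σ (suc k) = code n (RemoveMinimum.rest σ) k

inversionsAt≡code : ∀ n σ k → inversionsAt σ (σ ⟨$⟩ˡ inject₁ k) ≡ code n σ k
inversionsAt≡code (suc n) σ zero    = RemoveMinimum.inversionsAt-position σ
inversionsAt≡code (suc n) σ (suc k) = begin
  inversionsAt σ (σ ⟨$⟩ˡ suc (inject₁ k))
    ≡⟨ cong (inversionsAt σ) (from-suc (inject₁ k)) ⟩
  inversionsAt σ (punchIn position (rest ⟨$⟩ˡ inject₁ k))
    ≡⟨ inversionsAt-off-position _ ⟩
  inversionsAt rest (rest ⟨$⟩ˡ inject₁ k)
    ≡⟨ inversionsAt≡code n rest k ⟩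
  code n rest k ∎
  where
  open ≡-Reasoning
  open RemoveMinimum σ

inversionWord≗code : ∀ {n} (σ : Permutation′ (suc n)) → inversionWord σ ≗ code n σ
inversionWord≗code σ k = trans
  (inversionWord≡inversionsAt σ k (inject₁ k) (Fin.toℕ-inject₁ k)) (inversionsAt≡code _ σ k)

sum-inversionsAt : ∀ n σ → sum (inversionsAt σ) ≡ sum (code n σ)
sum-inversionsAt zero    σ = refl
sum-inversionsAt (suc n) σ = trans
  (sum-remove {i = position} (inversionsAt σ))
  (cong₂ _+_ inversionsAt-position
    (trans (sum-cong-≗ inversionsAt-off-position) (sum-inversionsAt n rest)))
  where open RemoveMinimum σ

-- Bijectivity of the code

code-bounded : ∀ n σ k → code n σ k ≤ n ∸ toℕ k
code-bounded (suc n) σ zero    = Fin.toℕ≤pred[n] (RemoveMinimum.position σ)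
code-bounded (suc n) σ (suc k) = code-bounded n (RemoveMinimum.rest σ) k

-- The relation `≈` compares forward maps, whereas the position of the minimum comes from the
-- inverse map; the inverse laws transfer the agreement.
code-cong : ∀ n {σ τ} → σ ≈ τ → code n σ ≗ code n τ
code-cong (suc n) {σ} {τ} σ≈τ = λ where
    zero    → cong toℕ same-position
    (suc k) → code-cong n same-rest k
  where
  module S = RemoveMinimum σ
  module T = RemoveMinimum τ
  same-position : S.position ≡ T.position
  same-position = trans (sym (inverseˡ τ))
    (cong (τ ⟨$⟩ˡ_) (trans (sym (σ≈τ S.position)) S.at-position))
  same-rest : S.rest ≈ T.rest
  same-rest j = Fin.suc-injective (begin
    suc (S.rest ⟨$⟩ʳ j)             ≡⟨ S.off-position j ⟨
    σ ⟨$⟩ʳ punchIn S.position j     ≡⟨ σ≈τ _ ⟩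
    τ ⟨$⟩ʳ punchIn S.position j     ≡⟨ cong (λ c → τ ⟨$⟩ʳ punchIn c j) same-position ⟩
    τ ⟨$⟩ʳ punchIn T.position j     ≡⟨ T.off-position j ⟩
    suc (T.rest ⟨$⟩ʳ j)             ∎)
    where open ≡-Reasoning

-- The first letter locates the minimum, and the other letters determine the remaining permutation
-- by induction.
code-injective : ∀ n {σ τ} → code n σ ≗ code n τ → σ ≈ τ
code-injective zero {σ} {τ} _ i with σ ⟨$⟩ʳ i | τ ⟨$⟩ʳ i
... | zero | zero = refl
code-injective (suc n) {σ} {τ} eq i = helper (S.position Fin.≟ i)
  where
  open ≡-Reasoning
  module S = RemoveMinimum σ
  module T = RemoveMinimum τ
  same-position : S.position ≡ T.position
  same-position = Fin.toℕ-injective (eq zero)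
  helper : Dec (S.position ≡ i) → σ ⟨$⟩ʳ i ≡ τ ⟨$⟩ʳ i
  helper (yes refl) = trans S.at-position
    (sym (trans (cong (τ ⟨$⟩ʳ_) same-position) T.at-position))
  helper (no c≢i) = subst (λ l → σ ⟨$⟩ʳ l ≡ τ ⟨$⟩ʳ l) (Fin.punchIn-punchOut c≢i) (begin
    σ ⟨$⟩ʳ punchIn S.position j     ≡⟨ S.off-position j ⟩
    suc (S.rest ⟨$⟩ʳ j)             ≡⟨ cong suc (code-injective n (eq ∘ suc) j) ⟩
    suc (T.rest ⟨$⟩ʳ j)             ≡⟨ T.off-position j ⟨
    τ ⟨$⟩ʳ punchIn T.position j     ≡⟨ cong (λ c → τ ⟨$⟩ʳ punchIn c j) same-position ⟨
    τ ⟨$⟩ʳ punchIn S.position j     ∎)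
    where j = punchOut c≢i

-- A new minimum is inserted at position `a zero` into a permutation that realizes the other
-- letters.
code-surjective : ∀ n (a : Fin n → ℕ) → (∀ k → a k ≤ n ∸ toℕ k) → ∃[ σ ] code n σ ≗ a
code-surjective zero    a _ = idₚ , λ ()
code-surjective (suc n) a a≤ with ρ , ρ-code ← code-surjective n (a ∘ suc) (a≤ ∘ suc) =
  insert c zero ρ , λ where
    zero    → Fin.toℕ-fromℕ< (s≤s (a≤ zero))
    (suc k) → trans (code-cong n (remove-insert c zero ρ) k) (ρ-code k)
  where
  c = fromℕ< (s≤s (a≤ zero))

-- Permutation matrices

permutationMatrix≡1⇒ : ∀ {m} (σ : Permutation′ m) {i j} → permutationMatrix σ i j ≡ 1 → σ ⟨$⟩ʳ j ≡ i
permutationMatrix≡1⇒ σ {i} {j} eq with σ ⟨$⟩ʳ j Fin.≟ i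
... | yes σj≡i = σj≡i

permutationMatrix≡1⇐ : ∀ {m} (σ : Permutation′ m) {i j} → σ ⟨$⟩ʳ j ≡ i → permutationMatrix σ i j ≡ 1
permutationMatrix≡1⇐ σ {i} {j} σj≡i =
  cong (if_then 1 else 0) (dec-true (σ ⟨$⟩ʳ j Fin.≟ i) σj≡i)

permutationMatrix-injective : ∀ {m} (σ τ : Permutation′ m) →
  (∀ i j → permutationMatrix σ i j ≡ permutationMatrix τ i j) → σ ≈ τ
permutationMatrix-injective σ τ eq j =
  sym (permutationMatrix≡1⇒ τ (trans (sym (eq _ j)) (permutationMatrix≡1⇐ σ refl)))

permutationMatrix-cong : ∀ {m} (σ τ : Permutation′ m) → σ ≈ τ →
  ∀ i j → permutationMatrix σ i j ≡ permutationMatrix τ i j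
permutationMatrix-cong σ τ σ≈τ i j = cong (λ k → if does (k Fin.≟ i) then 1 else 0) (σ≈τ j)

-- The bijections

open DPPWithoutSpecialParts

module _ {n : ℕ} where

  multiplicities : DPPWithoutSpecialParts (suc n) → Fin n → ℕ
  multiplicities π = multiplicityWord (suc n) (array π)

  durfeeRows : (π : DPPWithoutSpecialParts (suc n)) → DurfeeRows (array π)
  durfeeRows π = isDPP⇒durfeeRows (isDPP π) (noSpecialParts π)

  parts≡fromMultiplicities : ∀ π → parts (array π) ≡ fromMultiplicities n (multiplicities π)
  parts≡fromMultiplicities π = decreasing⇒fromMultiplicities n (multiplicities π)
    (durfeeRows-decreasing (durfeeRows π)) (isDPP⇒parts≥2 (isDPP π) (durfeeRows π))
    (hasDimension π) (λ _ → refl)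

  multiplicities-bounded : ∀ π → IsBounded (suc n) (multiplicities π)
  -- The value `suc n ∸ toℕ i` occurs fewer times than its own size; taking predecessors gives the
  -- bound.
  multiplicities-bounded π i = subst (multiplicities π i ≤_) (pred[m∸n]≡m∸[1+n] (suc n) (toℕ i))
    (pred-mono-≤ (isDPP⇒count< (isDPP π) (durfeeRows π) (m<n⇒0<n∸m (<-trans (Fin.toℕ<n i) (n<1+n n)))))

  multiplicities-injective : ∀ {π ρ} → multiplicities π ≗ multiplicities ρ → array π ≡ array ρ
  multiplicities-injective {π} {ρ} eq = durfeeRows-unique (durfeeRows π) (durfeeRows ρ) (begin
    parts (array π)                           ≡⟨ parts≡fromMultiplicities π ⟩
    fromMultiplicities n (multiplicities π)   ≡⟨ fromMultiplicities-cong n eq ⟩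
    fromMultiplicities n (multiplicities ρ)   ≡⟨ parts≡fromMultiplicities ρ ⟨
    parts (array ρ)                           ∎)
    where open ≡-Reasoning

  multiplicities-cong : ∀ {π ρ} → array π ≡ array ρ → multiplicities π ≗ multiplicities ρ
  multiplicities-cong eq i = cong (multiplicity (suc n ∸ toℕ i)) eq

  multiplicities-surjective : ∀ a → IsBounded (suc n) a → ∃[ π ] multiplicities π ≗ a
  multiplicities-surjective a a≤
    with π , d , eq ← durfeeRows-exists _ (fromMultiplicities n a) ≤-refl
           (fromMultiplicities-decreasing n a) (All.map (≤-trans (s≤s z≤n)) (fromMultiplicities-≥2 n a))
    = record
      { array          = π
      ; isDPP          = durfeeRows⇒isDPP d
          (subst (All (0 <_)) (sym eq) (All.map (≤-trans (s≤s z≤n)) (fromMultiplicities-≥2 n a)))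
          (λ {v} 0<v → subst (λ xs → count v xs < v) (sym eq) (count-fromMultiplicities-< n a a≤ 0<v))
      ; hasDimension   = subst (All (_≤ suc n)) (sym eq) (fromMultiplicities-≤ n a)
      ; noSpecialParts = durfeeRows⇒noSpecial d
      }
    , λ i → trans (cong (count (suc n ∸ toℕ i)) eq) (count-fromMultiplicities n a i)

  toPermutation : DPPWithoutSpecialParts (suc n) → Permutation′ (suc n)
  toPermutation π = proj₁ (code-surjective n (multiplicities π) (multiplicities-bounded π))

  code-toPermutation : ∀ π → code n (toPermutation π) ≗ multiplicities π
  code-toPermutation π = proj₂ (code-surjective n (multiplicities π) (multiplicities-bounded π))

  -- The construction also takes the proof of the bounds as input, so the permutations are compared
  -- through their codes.
  toPermutation-cong : ∀ {π ρ} → array π ≡ array ρ → toPermutation π ≈ toPermutation ρ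
  toPermutation-cong {π} {ρ} eq = code-injective n λ k → trans (code-toPermutation π k)
    (trans (multiplicities-cong {π} {ρ} eq k) (sym (code-toPermutation ρ k)))

  toPermutation-injective : ∀ {π ρ} → toPermutation π ≈ toPermutation ρ → array π ≡ array ρ
  toPermutation-injective {π} {ρ} eq = multiplicities-injective {π} {ρ} λ k →
    trans (sym (code-toPermutation π k)) (trans (code-cong n eq k) (code-toPermutation ρ k))

  toPermutation-surjective : ∀ σ → ∃[ π ] toPermutation π ≈ σ
  toPermutation-surjective σ = let π , eq = multiplicities-surjective (code n σ) (code-bounded n σ) in
    π , code-injective n λ k → trans (code-toPermutation π k) (eq k)

  wordBijection : Bijection (DPPSetoid (suc n)) (BoundedWordSetoid (suc n))
  wordBijection = record
    { to        = λ π → multiplicities π , multiplicities-bounded π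
    ; cong      = λ {π} {ρ} → multiplicities-cong {π} {ρ}
    ; bijective = (λ {π} {ρ} → multiplicities-injective {π} {ρ})
                , λ (a , a≤) → let π , eq = multiplicities-surjective a a≤ in
                    π , λ {ρ} ρ≈π i → trans (multiplicities-cong {ρ} {π} ρ≈π i) (eq i)
    }

  permutationBijection : Bijection (DPPSetoid (suc n)) (PermutationSetoid (suc n))
  permutationBijection = record
    { to        = toPermutation
    ; cong      = λ {π} {ρ} → toPermutation-cong {π} {ρ}
    ; bijective = (λ {π} {ρ} → toPermutation-injective {π} {ρ})
                , λ σ → let π , eq = toPermutation-surjective σ in
                    π , λ {ρ} ρ≈π i → trans (toPermutation-cong {ρ} {π} ρ≈π i) (eq i)
    }

  matrixBijection : Bijection (DPPSetoid (suc n)) (PermutationMatrixSetoid (suc n))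
  matrixBijection = record
    { to        = λ π → permutationMatrix (toPermutation π) , toPermutation π , λ _ _ → refl
    ; cong      = λ {π} {ρ} π≈ρ (i , j) → permutationMatrix-cong (toPermutation π) (toPermutation ρ)
                    (toPermutation-cong {π} {ρ} π≈ρ) i j
    ; bijective = (λ {π} {ρ} eq → toPermutation-injective {π} {ρ}
                    (permutationMatrix-injective (toPermutation π) (toPermutation ρ) (λ i j → eq (i , j))))
                , λ (M , σ , M≡σ) → let π , eq = toPermutation-surjective σ in
                    π , λ {ρ} ρ≈π (i , j) → trans
                      (permutationMatrix-cong (toPermutation ρ) σ
                        (λ k → trans (toPermutation-cong {ρ} {π} ρ≈π k) (eq k)) i j)
                      (sym (M≡σ i j))
    }

  length-parts : ∀ π → length (parts (array π)) ≡ length (inversions (toPermutation π))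
  length-parts π = begin
    length (parts (array π))                           ≡⟨ cong length (parts≡fromMultiplicities π) ⟩
    length (fromMultiplicities n (multiplicities π))   ≡⟨ length-fromMultiplicities n _ ⟩
    sum (multiplicities π)                             ≡⟨ sum-cong-≗ (code-toPermutation π) ⟨
    sum (code n (toPermutation π))                     ≡⟨ sum-inversionsAt n (toPermutation π) ⟨
    sum (inversionsAt (toPermutation π))               ≡⟨ length-inversions (toPermutation π) ⟨
    length (inversions (toPermutation π))              ∎
    where open ≡-Reasoning

position-of-minimum : ∀ n (π : DPPWithoutSpecialParts (suc n)) →
  toℕ (toPermutation π ⟨$⟩ˡ zero) ≡ multiplicity (suc n) (array π)
-- For m = 1 the code has no letters: there is a single position, and the partition has no parts.
position-of-minimum zero π = trans
  (n<1⇒n≡0 (Fin.toℕ<n (toPermutation π ⟨$⟩ˡ zero)))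
  (sym (cong (count 1) (parts≡fromMultiplicities π)))
position-of-minimum (suc n) π = code-toPermutation π zero

mainTheorem1 : (m : ℕ) (m≥1 : 1 ≤ m) →
    (Σ[ f ∈ Bijection (DPPSetoid m) (BoundedWordSetoid m) ]
    (∀ π → proj₁ (Bijection.to f π) ≗ multiplicityWord m (array π)))
    ×
    (Σ[ g ∈ Bijection (DPPSetoid m) (PermutationSetoid m) ]
    (∀ π → inversionWord (Bijection.to g π) ≗ multiplicityWord m (array π))
    × (∀ π (τ : Permutation′ m) →
    inversionWord τ ≗ multiplicityWord m (array π) →
    τ ≈ Bijection.to g π)
    × (Σ[ h ∈ Bijection (DPPSetoid m) (PermutationMatrixSetoid m) ]
    (∀ π i j → proj₁ (Bijection.to h π) i j
    ≡ permutationMatrix (Bijection.to g π) i j))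
    × (∀ π → length (parts (array π)) ≡ length (inversions (Bijection.to g π)))
    × (∀ π (k : ℕ) → 1 ≤ k → multiplicity m (array π) ≡ k ∸ 1 →
    ∃[ c ] (suc (toℕ c) ≡ k
    × permutationMatrix (Bijection.to g π) (fromℕ< m≥1) c ≡ 1
    × (∀ (j : Fin m) →
    permutationMatrix (Bijection.to g π) (fromℕ< m≥1) j ≡ 1 →
    j ≡ c))))
mainTheorem1 (suc n) _ =
    (wordBijection , λ _ _ → refl)
  , permutationBijection
  , (λ π k → trans (inversionWord≗code (toPermutation π) k) (code-toPermutation π k))
  , (λ π τ eq → code-injective n λ k → trans (sym (inversionWord≗code τ k))
      (trans (eq k) (sym (code-toPermutation π k))))
  , (matrixBijection , λ _ _ _ → refl)
  , length-parts
  -- The column is the position of the minimum; counted from zero, it is the number of parts equal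
  -- to m.
  , λ { π (suc k) _ eq → let σ = toPermutation π in
        σ ⟨$⟩ˡ zero
      , cong suc (trans (position-of-minimum n π) eq)
      , permutationMatrix≡1⇐ σ (inverseʳ σ)
      , λ j Mj≡1 → trans (sym (inverseˡ σ)) (cong (σ ⟨$⟩ˡ_) (permutationMatrix≡1⇒ σ Mj≡1)) }
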